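{- Let $u,v\in\mathbb{N}$ and let $A$ be a $u\times v$ matrix with entries from $\mathbb{Q}[i]$ which is image partition regular over $\mathbb{Z}[i]$. The following are equivalent: (a) For every piecewise syndetic subset $P$ of $\mathbb{Z}[i]\setminus\{0\}$ (piecewise syndetic in $(\mathbb{Z}[i],+)$), there exists $\vec{z}\in(\mathbb{Z}[i]\setminus\{0\})^{v}$ such that $A\vec{z}\in P^{u}$; (b) There exists $\vec{z}\in(\mathbb{Z}[i])^{v}$ such that $A\vec{z}=\vec{1}$, where $\vec{1}$ denotes the vector in $(\mathbb{Z}[i])^{u}$ whose entries are all equal to $1$.
   Context: $\mathbb{Z}[i]$ is the ring of Gaussian integers and $\mathbb{Q}[i]=\{a+bi:a,b\in\mathbb{Q}\}$. A $u\times v$ matrix $A$ with entries in $\mathbb{Q}[i]$ is image partition regular over $\mathbb{Z}[i]$ if for every $k\in\mathbb{N}$ and every partition $\mathbb{Z}[i]\setminus\{0\}=\bigcup_{j=1}^k D_j$ there are $j$ and $\vec{x}\in(\mathbb{Z}[i]\setminus\{0\})^v$ with $A\vec{x}\in D_j^u$. In a commutative semigroup $(S,+)$, a set $B\subseteq S$ is piecewise syndetic if there is a finite nonempty $G\subseteq S$ such that for every finite nonempty $F\subseteq S$ there is $x\in S$ with $F+x\subseteq\bigcup_{t\in G}(-t+B)$, where $-t+B=\{s\in S:t+s\in B\}$. For $P\subseteq\mathbb{Z}[i]$, $P^u$ is the set of vectors in $(\mathbb{Z}[i])^u$ all of whose entries lie in $P$. -}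

module Defs where

open import Data.Nat using (ℕ)
open import Data.Integer as ℤ using (ℤ)
open import Data.Rational as ℚ using (ℚ)
open import Data.Fin using (Fin)
open import Data.Product using (_×_; _,_; Σ; ∃; proj₁; proj₂)
open import Data.List using (List; [])
open import Data.List.Membership.Propositional using (_∈_)
open import Data.Vec.Functional using (foldr)
open import Relation.Binary.PropositionalEquality using (_≡_)
open import Relation.Nullary using (¬_)

-- Gaussian integers ℤ[i] : a + b i represented as (a , b)
ℤi : Set
ℤi = ℤ × ℤ

0ℤi : ℤi
0ℤi = (ℤ.0ℤ , ℤ.0ℤ)

_+ℤi_ : ℤi → ℤi → ℤi
(a , b) +ℤi (c , d) = (a ℤ.+ c , b ℤ.+ d)

-- Gaussian rationals ℚ[i] : a + b i with a b ∈ ℚ (normalised rationals, so ≡ is equality)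
ℚi : Set
ℚi = ℚ × ℚ

0ℚi : ℚi
0ℚi = (ℚ.0ℚ , ℚ.0ℚ)

1ℚi : ℚi
1ℚi = (ℚ.1ℚ , ℚ.0ℚ)

_+ℚi_ : ℚi → ℚi → ℚi
(a , b) +ℚi (c , d) = (a ℚ.+ c , b ℚ.+ d)

_*ℚi_ : ℚi → ℚi → ℚi
(a , b) *ℚi (c , d) = (a ℚ.* c ℚ.- b ℚ.* d , a ℚ.* d ℚ.+ b ℚ.* c)

ι : ℤi → ℚi
ι (a , b) = (a ℚ./ 1 , b ℚ./ 1)

Matrix : ℕ → ℕ → Set
Matrix u v = Fin u → Fin v → ℚi

_·_ : ∀ {u v} → Matrix u v → (Fin v → ℤi) → Fin u → ℚi
(A · z) i = foldr _+ℚi_ 0ℚi (λ j → A i j *ℚi ι (z j))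

ImageIn : ∀ {u v} → Matrix u v → (Fin v → ℤi) → (ℤi → Set) → Set
ImageIn {u} A z D = Σ (Fin u → ℤi) λ w → (∀ i → ι (w i) ≡ (A · z) i) × (∀ i → D (w i))

NonZero : ℤi → Set
NonZero x = ¬ (x ≡ 0ℤi)

-- image partition regular over ℤ[i]: a partition of ℤ[i]∖{0} into k classes D_1..D_k
-- is given by a colouring c (its value at 0 is irrelevant)
ImagePartitionRegular : ∀ {u v} → Matrix u v → Set
ImagePartitionRegular {u} {v} A =
  (k : ℕ) (c : ℤi → Fin k) →
  Σ (Fin k) λ j → Σ (Fin v → ℤi) λ x →
    (∀ l → NonZero (x l)) × ImageIn A x (λ y → NonZero y × (c y ≡ j))

NonEmpty : {X : Set} → List X → Set
NonEmpty xs = ¬ (xs ≡ [])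

-- piecewise syndetic in (ℤ[i], +); -t + B = {s : t + s ∈ B}
PiecewiseSyndetic : (ℤi → Set) → Set
PiecewiseSyndetic B =
  Σ (List ℤi) λ G → NonEmpty G ×
    ((F : List ℤi) → NonEmpty F →
      ∃ λ x → ∀ f → f ∈ F → ∃ λ t → t ∈ G × B (t +ℤi (f +ℤi x)))

{-# OPTIONS --safe #-}
-- (b) ⇒ (a): if A z = 1⃗, then A (n z) is constant for every n, so only nonvanishing of the entries is
-- at stake.  One colour in the definition of image partition regularity gives y with nonzero entries and
-- w = A y integral; then A (n z + d y) = n 1⃗ + d w, and a piecewise syndetic set contains homothetic
-- copies n + d W of every finite W (Gallai's theorem, in a finite form proved by colour focusing).
-- Taking W = {wᵢ + m : m ≤ v} leaves v + 1 choices of n, one of which makes all entries of n z + d y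
-- nonzero.
-- (a) ⇒ (b): for every N the nonzero Gaussian integers congruent to 1 modulo 2N are syndetic, so A z = 1⃗
-- (with denominators cleared) is solvable modulo N.  For a suitable N, found by eliminating one equation
-- at a time, an integer linear system solvable modulo N is solvable.
module Submission where

open import Defs
open import Data.Nat using (ℕ)
open import Data.Fin using (Fin)
open import Data.Product using (_×_; Σ)
open import Function.Bundles using (_⇔_)
open import Relation.Binary.PropositionalEquality using (_≡_)

open import Data.Empty using (⊥; ⊥-elim)
open import Data.Fin as Fin using (zero; suc; combine)
import Data.Fin.Properties as Fin
open import Data.Integer as ℤ using (ℤ; +_; ∣_∣; _+_; _*_; -_; 0ℤ; 1ℤ)
open import Data.Integer.Divisibility.Signed using (_∣_; divides; _∣?_; ∣⇒∣ᵤ; m∣∣m∣)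
open import Data.Integer.DivMod using (_%_; _/_; n%d<d; a≡a%n+[a/n]*n)
import Data.Integer.Properties as ℤ
open import Data.Integer.Tactic.RingSolver using (solve-∀)
open import Data.List
  using (List; []; _∷_; _++_; length; lookup; map; tabulate; upTo; allFin; cartesianProductWith)
import Data.List.Membership.DecPropositional as DecMembership
open import Data.List.Membership.Propositional using (_∈_)
open import Data.List.Membership.Propositional.Properties
  using (∈-cartesianProductWith⁺; ∈-map⁺; ∈-upTo⁺; ∈-allFin)
open import Data.List.Properties using (length-map)
open import Data.List.Relation.Unary.All as All using (All; []; _∷_)
import Data.List.Relation.Unary.All.Properties as All
open import Data.List.Relation.Unary.Any as Any using (here; there)
import Data.List.Relation.Unary.Any.Properties as Any
open import Data.Nat as ℕ using (zero; suc; s≤s; z≤n)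
import Data.Nat.Divisibility as ℕ
open import Data.Nat.Induction using (<-wellFounded)
import Data.Nat.Properties as ℕ
open import Data.Product using (_,_; ∃; proj₁; proj₂; ∃-syntax)
open import Data.Product.Properties using (≡-dec)
open import Data.Rational as ℚ using (ℚ; mkℚ)
import Data.Rational.Properties as ℚ
import Data.Rational.Solver as ℚSolver
open import Data.Rational.Unnormalised as ℚᵘ using (mkℚᵘ; *≡*)
import Data.Rational.Unnormalised.Properties as ℚᵘ
open import Data.Sum using (inj₁; inj₂; [_,_]′)
open import Data.Vec using (Vec; []; _∷_; zipWith; replicate)
open import Data.Vec.Functional using (foldr)
open import Function.Base using (_∘_)
open import Function.Bundles using (mk⇔)
open import Induction.WellFounded using (Acc; acc)
open import Relation.Binary.Definitions using (DecidableEquality)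
open import Relation.Binary.PropositionalEquality
  using (refl; sym; trans; cong; cong₂; subst; module ≡-Reasoning)
open import Relation.Nullary using (¬_; yes; no; contradiction)
open import Relation.Nullary.Decidable using (¬?; decidable-stable)
open ℚSolver.+-*-Solver using (_:+_; _:*_; _:-_; _:=_; con) renaming (solve to solveℚ)

-- Homothetic copies in finitely coloured Gaussian integers

-- The ratio is a natural number rather than a Gaussian integer, so that positive ratios cannot
-- cancel when two homotheties are added.
homothety : ℤi → ℕ → ℤi → ℤi
homothety (a , b) d (x , y) = (a + + d * x , b + + d * y)

homothety-+ : ∀ p d q e w →
  homothety (p +ℤi q) (d ℕ.+ e) w ≡ homothety p d w +ℤi homothety q e w
homothety-+ (a , b) d (a′ , b′) e (x , y) =
  cong₂ _,_ (lemma a a′ (+ d) (+ e) x) (lemma b b′ (+ d) (+ e) y)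
  where
  lemma : ∀ a b d e x → (a + b) + (d + e) * x ≡ (a + d * x) + (b + e * x)
  lemma = solve-∀

homothety-translateʳ : ∀ p d q w → homothety (p +ℤi q) d w ≡ homothety p d w +ℤi q
homothety-translateʳ (a , b) d (a′ , b′) (x , y) =
  cong₂ _,_ (lemma a a′ (+ d) x) (lemma b b′ (+ d) y)
  where
  lemma : ∀ a b d x → (a + b) + d * x ≡ (a + d * x) + b
  lemma = solve-∀

homothety-translateˡ : ∀ q p d w → homothety (q +ℤi p) d w ≡ q +ℤi homothety p d w
homothety-translateˡ (a , b) (a′ , b′) d (x , y) =
  cong₂ _,_ (ℤ.+-assoc a a′ _) (ℤ.+-assoc b b′ _)

_⊕_ : List ℤi → List ℤi → List ℤi
_⊕_ = cartesianProductWith _+ℤi_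

-- A code for the pattern of `χ` on `F`. Colouring `a` by the code of `χ (a + ·)` is the product
-- colouring of the focusing argument, with `k ^ length F` colours.
restriction : ∀ {k} (F : List ℤi) → (ℤi → Fin k) → Fin (k ℕ.^ length F)
restriction []      χ = zero
restriction (f ∷ F) χ = combine (χ f) (restriction F χ)

restriction-injective : ∀ {k} F {χ χ′ : ℤi → Fin k} →
  restriction F χ ≡ restriction F χ′ → ∀ {f} → f ∈ F → χ f ≡ χ′ f
restriction-injective (f ∷ F) {χ} {χ′} eq (here refl) =
  Fin.combine-injectiveˡ (χ f) (restriction F χ) (χ′ f) (restriction F χ′) eq
restriction-injective (f ∷ F) {χ} {χ′} eq (there f∈F) =
  restriction-injective F (Fin.combine-injectiveʳ (χ f) (restriction F χ) (χ′ f) (restriction F χ′) eq) f∈F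

-- Ω contains all the points whose homothetic copies are ever considered, so that a colouring only
-- matters on F; w₁ is a reference point whose copy carries the colour.
module ColourFocusing (Ω : List ℤi) (w₁ : ℤi) (w₁∈Ω : w₁ ∈ Ω) where

  record Homothet (F : List ℤi) : Set where
    constructor homothet
    field
      base   : ℤi
      ratio  : ℕ
      ratio>0 : 0 ℕ.< ratio
      inside : ∀ {w} → w ∈ Ω → homothety base ratio w ∈ F

  open Homothet

  at : ∀ {F} → Homothet F → ℤi → ℤi
  at h = homothety (base h) (ratio h)

  -- `w₁` need not lie in `ws`: the condition is vacuous for empty `ws`, and every copy nevertheless
  -- has a colour to be compared with others.
  Monochromatic : ∀ {k F} → (ℤi → Fin k) → List ℤi → Homothet F → Set
  Monochromatic χ ws h = ∀ {w} → w ∈ ws → χ (at h w) ≡ χ (at h w₁)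

  -- The set `F` is chosen before the colouring. This finite form makes product colourings over `F`
  -- finite, and it suits thickness, which controls only finite sets.
  Gallai : ℕ → List ℤi → Set
  Gallai k ws = Σ (List ℤi) λ F → (χ : ℤi → Fin k) → Σ (Homothet F) (Monochromatic χ ws)

  _⊞_ : ∀ {F F′} → Homothet F → Homothet F′ → Homothet (F ⊕ F′)
  homothet p d d>0 in₁ ⊞ homothet q e e>0 in₂ =
    homothet (p +ℤi q) (d ℕ.+ e) (ℕ.m≤n⇒m≤n+o e d>0) λ w∈Ω →
      subst (_∈ _) (sym (homothety-+ p d q e _)) (∈-cartesianProductWith⁺ _+ℤi_ (in₁ w∈Ω) (in₂ w∈Ω))

  translateʳ : ∀ {F F′ q} → Homothet F → q ∈ F′ → Homothet (F ⊕ F′)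
  translateʳ {q = q} (homothet p d d>0 in₁) q∈F′ =
    homothet (p +ℤi q) d d>0 λ w∈Ω →
      subst (_∈ _) (sym (homothety-translateʳ p d q _)) (∈-cartesianProductWith⁺ _+ℤi_ (in₁ w∈Ω) q∈F′)

  translateˡ : ∀ {F F′ q} → q ∈ F → Homothet F′ → Homothet (F ⊕ F′)
  translateˡ {q = q} q∈F (homothet p d d>0 in₁) =
    homothet (q +ℤi p) d d>0 λ w∈Ω →
      subst (_∈ _) (sym (homothety-translateˡ q p d _)) (∈-cartesianProductWith⁺ _+ℤi_ q∈F (in₁ w∈Ω))

  -- The usual requirement that the r copies have distinct colours is relaxed to: a coincidence of
  -- colours yields the sought copy.
  record Focused {k} (F : List ℤi) (χ : ℤi → Fin k) (ws : List ℤi) (w₀ : ℤi) (r : ℕ) : Set where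
    field
      focus       : ℤi
      focus∈F     : focus ∈ F
      copy        : Fin r → Homothet F
      mono        : ∀ i → Monochromatic χ ws (copy i)
      focused     : ∀ i → at (copy i) w₀ ≡ focus
      coincidence : ∀ {i j} → i Fin.< j → χ (at (copy i) w₁) ≡ χ (at (copy j) w₁) →
                    Σ (Homothet F) (Monochromatic χ (w₀ ∷ ws))

  -- Induction on `r`. If `F′` serves for `r` copies, a copy `h` of `ws` is found whose translates
  -- of `F′` all carry the same pattern. Adding `h` to the `r` copies inside the common pattern
  -- moves their focus to `at h w₀ +ℤi focus`, and `h` translated by the old focus is one more copy
  -- with that focus.
  focus-copies : ∀ {k ws w₀} → (∀ {w} → w ∈ ws → w ∈ Ω) → w₀ ∈ Ω → (∀ l → Gallai l ws) →
    ∀ r → Σ (List ℤi) λ F → (χ : ℤi → Fin k) → Focused F χ ws w₀ r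
  focus-copies _ _ _ zero = 0ℤi ∷ [] , λ χ → record
    { focus = 0ℤi ; focus∈F = here refl ; copy = λ () ; mono = λ () ; focused = λ ()
    ; coincidence = λ {i} → ⊥-elim (Fin.¬Fin0 i) }
  focus-copies {k} {ws} {w₀} ws⊆Ω w₀∈Ω gallai (suc r) = F ⊕ F′ , step
    where
    smaller = focus-copies {k} {ws} {w₀} ws⊆Ω w₀∈Ω gallai r
    F′ = proj₁ smaller
    F = proj₁ (gallai (k ℕ.^ length F′))

    step : (χ : ℤi → Fin k) → Focused (F ⊕ F′) χ ws w₀ (suc r)
    step χ = record
      { focus       = at h w₀ +ℤi focus
      ; focus∈F     = ∈-cartesianProductWith⁺ _+ℤi_ (inside h w₀∈Ω) focus∈F
      ; copy        = copies
      ; mono        = mono′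
      ; focused     = λ { zero    → at-zero w₀
                        ; (suc i) → trans (at-suc i w₀) (cong (at h w₀ +ℤi_) (focused i)) }
      ; coincidence = coincidence′
      }
      where
      -- The product colouring: `a` is coloured by the pattern of `χ` on `a` plus `F′`.
      -- Monochromaticity of `h` then means that this pattern is `χ₁` at every `at h w` with `w` in
      -- `ws`.
      translates = proj₂ (gallai (k ℕ.^ length F′)) (λ a → restriction F′ (λ f → χ (a +ℤi f)))
      h = proj₁ translates

      χ₁ : ℤi → Fin k
      χ₁ f = χ (at h w₁ +ℤi f)

      common : ∀ {w} → w ∈ ws → ∀ {f} → f ∈ F′ → χ (at h w +ℤi f) ≡ χ₁ f
      common w∈ws = restriction-injective F′ (proj₂ translates w∈ws)

      open Focused (proj₂ smaller χ₁)

      copies : Fin (suc r) → Homothet (F ⊕ F′)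
      copies zero    = translateʳ h focus∈F
      -- At `w` this is `at h w` plus `at (copy i) w`; the first summand does not affect the colour
      -- while `w` is in `ws`, and the second does not by induction.
      copies (suc i) = h ⊞ copy i

      at-zero : ∀ w → at (copies zero) w ≡ at h w +ℤi focus
      at-zero w = homothety-translateʳ (base h) (ratio h) focus w

      at-suc : ∀ i w → at (copies (suc i)) w ≡ at h w +ℤi at (copy i) w
      at-suc i w = homothety-+ (base h) (ratio h) (base (copy i)) (ratio (copy i)) w

      mono′ : ∀ i → Monochromatic χ ws (copies i)
      mono′ zero    w∈ws =
        trans (cong χ (at-zero _)) (trans (common w∈ws focus∈F) (cong χ (sym (at-zero w₁))))
      mono′ (suc i) w∈ws =
        trans (cong χ (at-suc i _)) (trans (common w∈ws (inside (copy i) (ws⊆Ω w∈ws)))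
          (trans (mono i w∈ws) (cong χ (sym (at-suc i w₁)))))

      untranslate : Σ (Homothet F′) (Monochromatic χ₁ (w₀ ∷ ws)) →
                    Σ (Homothet (F ⊕ F′)) (Monochromatic χ (w₀ ∷ ws))
      untranslate (g , g-mono) = translateˡ (inside h w₁∈Ω) g , λ w∈ →
        trans (cong χ (at-g _)) (trans (g-mono w∈) (cong χ (sym (at-g w₁))))
        where
        at-g : ∀ w → homothety (at h w₁ +ℤi base g) (ratio g) w ≡ at h w₁ +ℤi at g w
        at-g = homothety-translateˡ (at h w₁) (base g) (ratio g)

      -- The new copy has the colour `χ₁ focus`. If copy `j` has it too, then `j` extends to `w₀`,
      -- because it sends `w₀` to the focus.
      focus-has-colour : ∀ j → χ₁ focus ≡ χ₁ (at (copy j) w₁) →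
                         Σ (Homothet F′) (Monochromatic χ₁ (w₀ ∷ ws))
      focus-has-colour j eq = copy j , λ where
        (here refl)  → trans (cong χ₁ (focused j)) eq
        (there w∈ws) → mono j w∈ws

      coincidence′ : ∀ {i j} → i Fin.< j → χ (at (copies i) w₁) ≡ χ (at (copies j) w₁) →
                     Σ (Homothet (F ⊕ F′)) (Monochromatic χ (w₀ ∷ ws))
      coincidence′ {zero}  {suc j} _ eq = untranslate (focus-has-colour j
        (trans (cong χ (sym (at-zero w₁))) (trans eq (cong χ (at-suc j w₁)))))
      coincidence′ {suc i} {suc j} (s≤s i<j) eq = untranslate (coincidence i<j
        (trans (cong χ (sym (at-suc i w₁))) (trans eq (cong χ (at-suc j w₁)))))

  -- Induction on `ws`, for all numbers of colours at once because product colourings need more of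
  -- them. Among `k + 1` focused copies two share a colour, and that coincidence yields the copy
  -- which includes `w₀`.
  gallai : ∀ ws → (∀ {w} → w ∈ ws → w ∈ Ω) → ∀ k → Gallai k ws
  gallai []        _    k = map (homothety 0ℤi 1) Ω , λ χ →
    homothet 0ℤi 1 (s≤s z≤n) (∈-map⁺ (homothety 0ℤi 1)) , λ ()
  gallai (w₀ ∷ ws) ws⊆Ω k = proj₁ copies , λ χ →
    let open Focused (proj₂ copies χ)
        i , j , i<j , eq = Fin.pigeonhole (ℕ.n<1+n k) (λ i → χ (at (copy i) w₁))
    in coincidence i<j eq
    where
    copies = focus-copies {k} {ws} {w₀} (ws⊆Ω ∘ there) (ws⊆Ω (here refl)) (gallai ws (ws⊆Ω ∘ there)) (suc k)

-- Integer linear systems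

-- Euclid's algorithm, with the identity stated for the cofactors `p` and `q`, so that it has
-- content even when `d` is zero.
bezout : ∀ a b → Acc ℕ._<_ ∣ b ∣ →
  ∃[ d ] ∃[ p ] ∃[ q ] ∃[ α ] ∃[ β ] a ≡ p * d × b ≡ q * d × α * p + β * q ≡ 1ℤ
bezout a b (acc rec) with b ℤ.≟ 0ℤ
... | yes refl = a , 1ℤ , 0ℤ , 1ℤ , 0ℤ , sym (ℤ.*-identityˡ a) , refl , refl
... | no b≢0 =
  let d , p , q , α , β , b≡pd , r≡qd , eq = bezout b (+ (a % b)) (rec (n%d<d a b))
      t = a / b
  in d , q + t * p , p , β , α ℤ.- β * t
   , trans (a≡a%n+[a/n]*n a b) (trans (cong₂ (λ x y → x + t * y) r≡qd b≡pd) (lemma₁ q d t p))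
   , b≡pd , trans (lemma₂ p q α β t) eq
  where
  instance
    b-nonZero : ℤ.NonZero b
    b-nonZero = ℤ.≢-nonZero b≢0
  lemma₁ : ∀ q d t p → q * d + t * (p * d) ≡ (q + t * p) * d
  lemma₁ = solve-∀
  lemma₂ : ∀ p q α β t → β * (q + t * p) + (α ℤ.- β * t) * p ≡ α * p + β * q
  lemma₂ = solve-∀

_+[_]_ : ∀ {n} → Vec ℤ n → ℤ → Vec ℤ n → Vec ℤ n
x +[ k ] y = zipWith (λ a b → a + k * b) x y

-- One identity covers additivity and homogeneity. Forms are functions rather than coefficient
-- vectors, so that substitution into an equation is composition.
Linear : ∀ {n} → (Vec ℤ n → ℤ) → Set
Linear φ = ∀ x k y → φ (x +[ k ] y) ≡ φ x + k * φ y

0ᵛ : ∀ {n} → Vec ℤ n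
0ᵛ = replicate _ 0ℤ

+[]-0ᵛ : ∀ {n} (x : Vec ℤ n) k → x +[ k ] 0ᵛ ≡ x
+[]-0ᵛ []      k = refl
+[]-0ᵛ (a ∷ x) k = cong₂ _∷_ (lemma a k) (+[]-0ᵛ x k)
  where
  lemma : ∀ a k → a + k * 0ℤ ≡ a
  lemma = solve-∀

-- The image of `φ` is the cyclic group of `generator`. Keeping `multiple` as a linear map of its
-- own avoids division; for a nonzero generator it is the coordinate along `preimage` in a splitting
-- off of the kernel.
record Image {n} (φ : Vec ℤ n → ℤ) : Set where
  field
    generator : ℤ
    preimage  : Vec ℤ n
    hits      : φ preimage ≡ generator
    multiple  : Vec ℤ n → ℤ
    linear    : Linear multiple
    factor    : ∀ z → φ z ≡ multiple z * generator

-- Induction on the dimension: the value at the first basis vector and the generator for the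
-- remaining coordinates are merged into their greatest common divisor.
image-cyclic : ∀ {n} (φ : Vec ℤ n → ℤ) → Linear φ → Image φ
image-cyclic {zero} φ lin = record
  { generator = 0ℤ ; preimage = [] ; hits = φ[]≡0 ; multiple = λ _ → 0ℤ
  ; linear = λ _ k _ → sym (trans (ℤ.+-identityˡ _) (ℤ.*-zeroʳ k)) ; factor = λ { [] → φ[]≡0 } }
  where
  cancel : ∀ x → x + - 1ℤ * x ≡ 0ℤ
  cancel = solve-∀
  φ[]≡0 : φ [] ≡ 0ℤ
  φ[]≡0 = trans (lin [] (- 1ℤ) []) (cancel (φ []))
image-cyclic {suc n} φ lin =
  let d , p , q , α , β , e≡pd , d′≡qd , αp+βq≡1 = bezout (φ e) generator (<-wellFounded _)
  in record
  { generator = d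
  -- This is `α e + β (0 , preimage)`, with `α e` written as `e + (α - 1) e` to fit the only
  -- available operation.
  ; preimage  = (e +[ α ℤ.- 1ℤ ] e) +[ β ] (0ℤ ∷ preimage)
  ; hits      = begin
      φ ((e +[ α ℤ.- 1ℤ ] e) +[ β ] (0ℤ ∷ preimage))    ≡⟨ lin _ β _ ⟩
      φ (e +[ α ℤ.- 1ℤ ] e) + β * φ (0ℤ ∷ preimage)     ≡⟨ cong₂ (λ x y → x + β * y) (lin e (α ℤ.- 1ℤ) e) hits ⟩
      φ e + (α ℤ.- 1ℤ) * φ e + β * generator            ≡⟨ lemma₁ (φ e) α β generator ⟩
      α * φ e + β * generator                           ≡⟨ cong₂ (λ x y → α * x + β * y) e≡pd d′≡qd ⟩
      α * (p * d) + β * (q * d)                         ≡⟨ lemma₂ α p d β q ⟩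
      (α * p + β * q) * d                               ≡⟨ cong (_* d) αp+βq≡1 ⟩
      1ℤ * d                                            ≡⟨ ℤ.*-identityˡ d ⟩
      d                                                 ∎
  ; multiple  = λ { (a ∷ z) → a * p + multiple z * q }
  ; linear    = λ { (a ∷ x) k (b ∷ y) → trans (cong (λ m → (a + k * b) * p + m * q) (linear x k y))
                                              (lemma₃ a k b p (multiple x) (multiple y) q) }
  ; factor    = λ { (a ∷ z) → begin
      φ (a ∷ z)                                    ≡⟨ cong φ (cong₂ _∷_ (lemma₄ a) (sym (+[]-0ᵛ z a))) ⟩
      φ ((0ℤ ∷ z) +[ a ] e)                        ≡⟨ lin _ a e ⟩
      φ (0ℤ ∷ z) + a * φ e                         ≡⟨ cong₂ (λ x y → x + a * y) (factor z) e≡pd ⟩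
      multiple z * generator + a * (p * d)         ≡⟨ cong (λ x → multiple z * x + a * (p * d)) d′≡qd ⟩
      multiple z * (q * d) + a * (p * d)           ≡⟨ lemma₅ (multiple z) q d a p ⟩
      (a * p + multiple z * q) * d                 ∎ }
  }
  where
  open ≡-Reasoning
  e : Vec ℤ (suc n)
  e = 1ℤ ∷ 0ᵛ
  lemma₀ : ∀ k → 0ℤ + k * 0ℤ ≡ 0ℤ
  lemma₀ = solve-∀
  open Image (image-cyclic (λ z → φ (0ℤ ∷ z)) λ x k y →
    trans (cong (λ c → φ (c ∷ (x +[ k ] y))) (sym (lemma₀ k))) (lin (0ℤ ∷ x) k (0ℤ ∷ y)))
  lemma₁ : ∀ x α β y → x + (α ℤ.- 1ℤ) * x + β * y ≡ α * x + β * y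
  lemma₁ = solve-∀
  lemma₂ : ∀ α p d β q → α * (p * d) + β * (q * d) ≡ (α * p + β * q) * d
  lemma₂ = solve-∀
  lemma₃ : ∀ a k b p m m′ q → (a + k * b) * p + (m + k * m′) * q ≡ (a * p + m * q) + k * (b * p + m′ * q)
  lemma₃ = solve-∀
  lemma₄ : ∀ a → a ≡ 0ℤ + a * 1ℤ
  lemma₄ = solve-∀
  lemma₅ : ∀ m q d a p → m * (q * d) + a * (p * d) ≡ (a * p + m * q) * d
  lemma₅ = solve-∀

record Equation (n : ℕ) : Set where
  field
    lhs    : Vec ℤ n → ℤ
    linear : Linear lhs
    rhs    : ℤ

open Equation

Solvable : ∀ {n} → List (Equation n) → Set
Solvable E = ∃[ z ] All (λ e → lhs e z ≡ rhs e) E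

SolvableMod : ∀ {n} → ℕ → List (Equation n) → Set
SolvableMod N E = ∃[ z ] All (λ e → ∃[ s ] lhs e z ≡ rhs e + + N * s) E

-- The equations left for the coordinates complementary to a preimage g of the generator of the first
-- left-hand side, once the coefficient of g is known to be c.
eliminate : ∀ {n} {φ : Vec ℤ n → ℤ} → Image φ → ℤ → Equation n → Equation n
eliminate im c e = record
  { lhs    = λ z → lhs e (z +[ - multiple z ] preimage)
  ; linear = λ x k y → begin
      lhs e ((x +[ k ] y) +[ - multiple (x +[ k ] y) ] preimage)
        ≡⟨ linear e (x +[ k ] y) (- multiple (x +[ k ] y)) preimage ⟩
      lhs e (x +[ k ] y) + - multiple (x +[ k ] y) * lhs e preimage
        ≡⟨ cong₂ (λ a m → a + - m * lhs e preimage) (linear e x k y) (Image.linear im x k y) ⟩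
      lhs e x + k * lhs e y + - (multiple x + k * multiple y) * lhs e preimage
        ≡⟨ lemma (lhs e x) k (lhs e y) (multiple x) (multiple y) (lhs e preimage) ⟩
      (lhs e x + - multiple x * lhs e preimage) + k * (lhs e y + - multiple y * lhs e preimage)
        ≡⟨ cong₂ (λ a b → a + k * b) (linear e x (- multiple x) preimage) (linear e y (- multiple y) preimage) ⟨
      lhs e (x +[ - multiple x ] preimage) + k * lhs e (y +[ - multiple y ] preimage) ∎
  ; rhs    = rhs e ℤ.- c * lhs e preimage
  }
  where
  open Image im hiding (linear)
  open ≡-Reasoning
  lemma : ∀ a k b m m′ g → a + k * b + - (m + k * m′) * g ≡ (a + - m * g) + k * (b + - m′ * g)
  lemma = solve-∀

module _ {n} (e₀ : Equation n) (im : Image (lhs e₀)) where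
  open Image im renaming (generator to d; multiple to m; preimage to g) hiding (linear)
  open ≡-Reasoning

  vanishing-lhs : d ≡ 0ℤ → ∀ z → lhs e₀ z ≡ 0ℤ
  vanishing-lhs d≡0 z = trans (factor z) (trans (cong (m z *_) d≡0) (ℤ.*-zeroʳ (m z)))

  -- A solution would make the modulus divide the nonzero `rhs e₀`, whose absolute value it exceeds
  -- by one.
  vanishing-lhs⇒unsolvable : d ≡ 0ℤ → ¬ rhs e₀ ≡ 0ℤ →
    ∀ z s → ¬ lhs e₀ z ≡ rhs e₀ + + suc ∣ rhs e₀ ∣ * s
  vanishing-lhs⇒unsolvable d≡0 b≢0 z s eq =
    ℕ.<-irrefl refl (ℕ.∣⇒≤ {{ℕ.≢-nonZero (b≢0 ∘ ℤ.∣i∣≡0⇒i≡0)}} (∣⇒∣ᵤ (divides (- s) b≡-sN)))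
    where
    N = + suc ∣ rhs e₀ ∣
    lemma : ∀ b N s → b ≡ - s * N + (b + N * s)
    lemma = solve-∀
    b≡-sN : rhs e₀ ≡ - s * N
    b≡-sN = begin
      rhs e₀                           ≡⟨ lemma (rhs e₀) N s ⟩
      - s * N + (rhs e₀ + N * s)       ≡⟨ cong (λ x → - s * N + x) (trans (sym eq) (vanishing-lhs d≡0 z)) ⟩
      - s * N + 0ℤ                     ≡⟨ ℤ.+-identityʳ _ ⟩
      - s * N                          ∎

  -- Both the left-hand side and the multiple of the modulus are multiples of `d`.
  solvable-mod-generator⇒divides : ∀ z s → lhs e₀ z ≡ rhs e₀ + + ∣ d ∣ * s → d ∣ rhs e₀
  solvable-mod-generator⇒divides z s eq with m∣∣m∣ {d}
  ... | divides t ∣d∣≡td = divides (m z ℤ.- t * s) (begin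
      rhs e₀                                              ≡⟨ lemma₁ (rhs e₀) (+ ∣ d ∣) s ⟩
      (rhs e₀ + + ∣ d ∣ * s) ℤ.- + ∣ d ∣ * s              ≡⟨ cong₂ (λ x y → x ℤ.- y * s) (trans (sym eq) (factor z)) ∣d∣≡td ⟩
      m z * d ℤ.- t * d * s                               ≡⟨ lemma₂ (m z) d t s ⟩
      (m z ℤ.- t * s) * d                                 ∎)
    where
    lemma₁ : ∀ b N s → b ≡ (b + N * s) ℤ.- N * s
    lemma₁ = solve-∀
    lemma₂ : ∀ m d t s → m * d ℤ.- t * d * s ≡ (m ℤ.- t * s) * d
    lemma₂ = solve-∀

  module _ (d≢0 : ¬ d ≡ 0ℤ) (c : ℤ) (b≡cd : rhs e₀ ≡ c * d) where

    -- Subtracting `m z` times `g` puts `z` in the kernel of `lhs e₀`; adding `c` times `g` then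
    -- gives `e₀` its value `c * d`, and the right-hand sides of the eliminated equations already
    -- allow for that term.
    lift-solution : ∀ {E} → Solvable (map (eliminate im c) E) → Solvable (e₀ ∷ E)
    lift-solution (z , solves) = z′ , first ∷ All.map (λ {e} → rest e) (All.map⁻ solves)
      where
      z₀ = z +[ - m z ] g
      z′ = z₀ +[ c ] g
      lemma₁ : ∀ m d c → (m * d + - m * d) + c * d ≡ c * d
      lemma₁ = solve-∀
      first : lhs e₀ z′ ≡ rhs e₀
      first = begin
        lhs e₀ z′                                         ≡⟨ linear e₀ z₀ c g ⟩
        lhs e₀ z₀ + c * lhs e₀ g                          ≡⟨ cong (_+ c * lhs e₀ g) (linear e₀ z (- m z) g) ⟩
        (lhs e₀ z + - m z * lhs e₀ g) + c * lhs e₀ g      ≡⟨ cong₂ (λ x y → (x + - m z * y) + c * y) (factor z) hits ⟩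
        (m z * d + - m z * d) + c * d                     ≡⟨ lemma₁ (m z) d c ⟩
        c * d                                             ≡⟨ b≡cd ⟨
        rhs e₀                                            ∎
      lemma₂ : ∀ b x → (b ℤ.- x) + x ≡ b
      lemma₂ = solve-∀
      rest : ∀ e → lhs e z₀ ≡ rhs e ℤ.- c * lhs e g → lhs e z′ ≡ rhs e
      rest e eq = trans (linear e z₀ c g) (trans (cong (_+ c * lhs e g) eq) (lemma₂ (rhs e) (c * lhs e g)))

    -- Cancelling `d` in `e₀` costs the factor `∣ d ∣` of the modulus and leaves `m z` congruent to
    -- `c` modulo `N`. So the same `z` works: replacing `m z` by `c` changes each equation by a
    -- multiple of `N`.
    descend-solution : ∀ {E} N → SolvableMod (N ℕ.* ∣ d ∣) (e₀ ∷ E) → SolvableMod N (map (eliminate im c) E)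
    descend-solution N (z , (s₀ , eq₀) ∷ solves) with m∣∣m∣ {d}
    ... | divides t ∣d∣≡td = z , All.map⁺ (All.map (λ {e} → rest e) solves)
      where
      modulus : + (N ℕ.* ∣ d ∣) ≡ + N * + ∣ d ∣
      modulus = ℤ.pos-* N ∣ d ∣
      lemma₁ : ∀ c d N t s → c * d + N * (t * d) * s ≡ (c + N * t * s) * d
      lemma₁ = solve-∀
      m≡ : m z ≡ c + + N * t * s₀
      m≡ = ℤ.*-cancelʳ-≡ _ _ d {{ℤ.≢-nonZero d≢0}} (begin
        m z * d                                   ≡⟨ factor z ⟨
        lhs e₀ z                                  ≡⟨ eq₀ ⟩
        rhs e₀ + + (N ℕ.* ∣ d ∣) * s₀             ≡⟨ cong₂ (λ x y → x + y * s₀) b≡cd (trans modulus (cong (+ N *_) ∣d∣≡td)) ⟩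
        c * d + + N * (t * d) * s₀                ≡⟨ lemma₁ c d (+ N) t s₀ ⟩
        (c + + N * t * s₀) * d                    ∎)
      lemma₂ : ∀ b N D s c t s₀ x → (b + N * D * s) + - (c + N * t * s₀) * x ≡ (b ℤ.- c * x) + N * (D * s ℤ.- t * s₀ * x)
      lemma₂ = solve-∀
      rest : ∀ e → ∃[ s ] lhs e z ≡ rhs e + + (N ℕ.* ∣ d ∣) * s →
             ∃[ s ] lhs (eliminate im c e) z ≡ rhs (eliminate im c e) + + N * s
      rest e (s , eq) = + ∣ d ∣ * s ℤ.- t * s₀ * lhs e g , (begin
        lhs e (z +[ - m z ] g)                                     ≡⟨ linear e z (- m z) g ⟩
        lhs e z + - m z * lhs e g                                  ≡⟨ cong₂ (λ x y → x + - y * lhs e g) eq m≡ ⟩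
        (rhs e + + (N ℕ.* ∣ d ∣) * s) + - (c + + N * t * s₀) * lhs e g
          ≡⟨ cong (λ x → (rhs e + x * s) + - (c + + N * t * s₀) * lhs e g) modulus ⟩
        (rhs e + + N * + ∣ d ∣ * s) + - (c + + N * t * s₀) * lhs e g
          ≡⟨ lemma₂ (rhs e) (+ N) (+ ∣ d ∣) s c t s₀ (lhs e g) ⟩
        (rhs e ℤ.- c * lhs e g) + + N * (+ ∣ d ∣ * s ℤ.- t * s₀ * lhs e g) ∎)

-- Finitely generated abelian groups are subgroup separable.
solvable-of-mod : ∀ {n} (E : List (Equation n)) →
  ∃[ N ] ℕ.NonZero N × (SolvableMod N E → Solvable E)
solvable-of-mod E = go (length E) E refl
  where
  go : ∀ {n} l (E : List (Equation n)) → length E ≡ l →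
    ∃[ N ] ℕ.NonZero N × (SolvableMod N E → Solvable E)
  go zero [] _ = 1 , _ , λ _ → 0ᵛ , []
  go (suc l) (e₀ ∷ E) len with image-cyclic (lhs e₀) (linear e₀)
  ... | im with Image.generator im ℤ.≟ 0ℤ | rhs e₀ ℤ.≟ 0ℤ | Image.generator im ∣? rhs e₀
  ... | yes d≡0 | yes b≡0 | _ =
    let N , N≢0 , solve = go l E (ℕ.suc-injective len)
    in N , N≢0 , λ { (z , _ ∷ zs) → let z′ , zs′ = solve (z , zs) in
         z′ , trans (vanishing-lhs e₀ im d≡0 z′) (sym b≡0) ∷ zs′ }
  -- In this case and the next the first equation has no solution, and the modulus is one that
  -- already detects this.
  ... | yes d≡0 | no b≢0 | _ = suc ∣ rhs e₀ ∣ , _ ,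
    λ { (z , (s , eq) ∷ _) → contradiction eq (vanishing-lhs⇒unsolvable e₀ im d≡0 b≢0 z s) }
  ... | no d≢0 | _ | no d∤b = ∣ Image.generator im ∣ , ℕ.≢-nonZero (d≢0 ∘ ℤ.∣i∣≡0⇒i≡0) ,
    λ { (z , (s , eq) ∷ _) → contradiction (solvable-mod-generator⇒divides e₀ im z s eq) d∤b }
  ... | no d≢0 | _ | yes (divides c b≡cd) =
    let N , N≢0 , solve = go l (map (eliminate im c) E) (trans (length-map _ E) (ℕ.suc-injective len))
    in N ℕ.* ∣ Image.generator im ∣
     , ℕ.m*n≢0 N _ {{N≢0}} {{ℕ.≢-nonZero (d≢0 ∘ ℤ.∣i∣≡0⇒i≡0)}}
     , lift-solution e₀ im d≢0 c b≡cd ∘ solve ∘ descend-solution e₀ im d≢0 c b≡cd N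

-- Gaussian integers inside the Gaussian rationals

fromℤ : ℤ → ℚ
fromℤ a = a ℚ./ 1

-- Normalisation is dealt with here: the homomorphism laws below are checked on unnormalised
-- fractions with denominator 1.
toℚᵘ-fromℤ : ∀ a → ℚ.toℚᵘ (fromℤ a) ℚᵘ.≃ mkℚᵘ a 0
toℚᵘ-fromℤ a = ℚ.toℚᵘ-fromℚᵘ (mkℚᵘ a 0)

fromℤ-injective : ∀ {a b} → fromℤ a ≡ fromℤ b → a ≡ b
fromℤ-injective {a} {b} eq with ℚ.fromℚᵘ-injective {mkℚᵘ a 0} {mkℚᵘ b 0} eq
... | *≡* a*1≡b*1 = trans (sym (ℤ.*-identityʳ a)) (trans a*1≡b*1 (ℤ.*-identityʳ b))

fromℤ-homo-+ : ∀ a b → fromℤ (a + b) ≡ fromℤ a ℚ.+ fromℤ b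
fromℤ-homo-+ a b = ℚ.toℚᵘ-injective (begin
  ℚ.toℚᵘ (fromℤ (a + b))                       ≈⟨ toℚᵘ-fromℤ (a + b) ⟩
  mkℚᵘ (a + b) 0                               ≈⟨ *≡* (lemma a b) ⟩
  mkℚᵘ a 0 ℚᵘ.+ mkℚᵘ b 0                       ≈⟨ ℚᵘ.+-cong (toℚᵘ-fromℤ a) (toℚᵘ-fromℤ b) ⟨
  ℚ.toℚᵘ (fromℤ a) ℚᵘ.+ ℚ.toℚᵘ (fromℤ b)       ≈⟨ ℚ.toℚᵘ-homo-+ (fromℤ a) (fromℤ b) ⟨
  ℚ.toℚᵘ (fromℤ a ℚ.+ fromℤ b)                 ∎)
  where
  open ℚᵘ.≃-Reasoning
  lemma : ∀ a b → (a + b) * 1ℤ ≡ (a * 1ℤ + b * 1ℤ) * 1ℤ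
  lemma = solve-∀

fromℤ-homo-* : ∀ a b → fromℤ (a * b) ≡ fromℤ a ℚ.* fromℤ b
fromℤ-homo-* a b = ℚ.toℚᵘ-injective (begin
  ℚ.toℚᵘ (fromℤ (a * b))                       ≈⟨ toℚᵘ-fromℤ (a * b) ⟩
  mkℚᵘ (a * b) 0                               ≈⟨ *≡* refl ⟩
  mkℚᵘ a 0 ℚᵘ.* mkℚᵘ b 0                       ≈⟨ ℚᵘ.*-cong (toℚᵘ-fromℤ a) (toℚᵘ-fromℤ b) ⟨
  ℚ.toℚᵘ (fromℤ a) ℚᵘ.* ℚ.toℚᵘ (fromℤ b)       ≈⟨ ℚ.toℚᵘ-homo-* (fromℤ a) (fromℤ b) ⟨
  ℚ.toℚᵘ (fromℤ a ℚ.* fromℤ b)                 ∎)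
  where open ℚᵘ.≃-Reasoning

fromℤ-homo-neg : ∀ a → fromℤ (- a) ≡ ℚ.- fromℤ a
fromℤ-homo-neg a = ℚ.toℚᵘ-injective (begin
  ℚ.toℚᵘ (fromℤ (- a))          ≈⟨ toℚᵘ-fromℤ (- a) ⟩
  mkℚᵘ (- a) 0                  ≈⟨ ℚᵘ.-‿cong (toℚᵘ-fromℤ a) ⟨
  ℚᵘ.- ℚ.toℚᵘ (fromℤ a)         ≈⟨ ℚ.toℚᵘ-homo‿- (fromℤ a) ⟨
  ℚ.toℚᵘ (ℚ.- fromℤ a)          ∎)
  where open ℚᵘ.≃-Reasoning

clear-denominator : ∀ r → fromℤ (ℚ.↧ r) ℚ.* r ≡ fromℤ (ℚ.↥ r)
clear-denominator r@(mkℚ n d-1 _) = ℚ.toℚᵘ-injective (begin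
  ℚ.toℚᵘ (fromℤ (ℚ.↧ r) ℚ.* r)                 ≈⟨ ℚ.toℚᵘ-homo-* (fromℤ (ℚ.↧ r)) r ⟩
  ℚ.toℚᵘ (fromℤ (ℚ.↧ r)) ℚᵘ.* ℚ.toℚᵘ r         ≈⟨ ℚᵘ.*-congʳ {ℚ.toℚᵘ r} (toℚᵘ-fromℤ (ℚ.↧ r)) ⟩
  mkℚᵘ (+ suc d-1) 0 ℚᵘ.* mkℚᵘ n d-1           ≈⟨ *≡* (lemma (+ suc d-1) n) ⟩
  mkℚᵘ n 0                                     ≈⟨ toℚᵘ-fromℤ n ⟨
  ℚ.toℚᵘ (fromℤ n)                             ∎)
  where
  open ℚᵘ.≃-Reasoning
  lemma : ∀ d n → (d * n) * 1ℤ ≡ n * (1ℤ * d)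
  lemma = solve-∀

_*ℤi_ : ℤi → ℤi → ℤi
(a , b) *ℤi (c , d) = (a * c ℤ.- b * d , a * d + b * c)

ι-injective : ∀ {x y} → ι x ≡ ι y → x ≡ y
ι-injective eq = cong₂ _,_ (fromℤ-injective (cong proj₁ eq)) (fromℤ-injective (cong proj₂ eq))

ι-homo-+ : ∀ x y → ι (x +ℤi y) ≡ ι x +ℚi ι y
ι-homo-+ (a , b) (c , d) = cong₂ _,_ (fromℤ-homo-+ a c) (fromℤ-homo-+ b d)

ι-homo-* : ∀ x y → ι (x *ℤi y) ≡ ι x *ℚi ι y
ι-homo-* (a , b) (c , d) = cong₂ _,_
  (trans (fromℤ-homo-+ (a * c) (- (b * d)))
    (cong₂ ℚ._+_ (fromℤ-homo-* a c) (trans (fromℤ-homo-neg (b * d)) (cong ℚ.-_ (fromℤ-homo-* b d)))))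
  (trans (fromℤ-homo-+ (a * d) (b * c)) (cong₂ ℚ._+_ (fromℤ-homo-* a d) (fromℤ-homo-* b c)))

*ℚi-identityʳ : ∀ x → x *ℚi 1ℚi ≡ x
*ℚi-identityʳ (a , b) = cong₂ _,_
  (solveℚ 2 (λ a b → a :* con ℚ.1ℚ :- b :* con ℚ.0ℚ := a) refl a b)
  (solveℚ 2 (λ a b → a :* con ℚ.0ℚ :+ b :* con ℚ.1ℚ := b) refl a b)

*ℚi-linear : ∀ r c z d y s t →
  (r *ℚi ((c *ℚi z) +ℚi (d *ℚi y))) +ℚi ((c *ℚi s) +ℚi (d *ℚi t)) ≡
  (c *ℚi ((r *ℚi z) +ℚi s)) +ℚi (d *ℚi ((r *ℚi y) +ℚi t))
*ℚi-linear (r , r′) (c , c′) (z , z′) (d , d′) (y , y′) (s , s′) (t , t′) = cong₂ _,_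
  (solveℚ 14 (λ r r′ c c′ z z′ d d′ y y′ s s′ t t′ →
     (r :* ((c :* z :- c′ :* z′) :+ (d :* y :- d′ :* y′)) :- r′ :* ((c :* z′ :+ c′ :* z) :+ (d :* y′ :+ d′ :* y)))
       :+ ((c :* s :- c′ :* s′) :+ (d :* t :- d′ :* t′))
     := (c :* ((r :* z :- r′ :* z′) :+ s) :- c′ :* ((r :* z′ :+ r′ :* z) :+ s′))
       :+ (d :* ((r :* y :- r′ :* y′) :+ t) :- d′ :* ((r :* y′ :+ r′ :* y) :+ t′)))
     refl r r′ c c′ z z′ d d′ y y′ s s′ t t′)
  (solveℚ 14 (λ r r′ c c′ z z′ d d′ y y′ s s′ t t′ →
     (r :* ((c :* z′ :+ c′ :* z) :+ (d :* y′ :+ d′ :* y)) :+ r′ :* ((c :* z :- c′ :* z′) :+ (d :* y :- d′ :* y′)))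
       :+ ((c :* s′ :+ c′ :* s) :+ (d :* t′ :+ d′ :* t))
     := (c :* ((r :* z′ :+ r′ :* z) :+ s′) :+ c′ :* ((r :* z :- r′ :* z′) :+ s))
       :+ (d :* ((r :* y′ :+ r′ :* y) :+ t′) :+ d′ :* ((r :* y :- r′ :* y′) :+ t)))
     refl r r′ c c′ z z′ d d′ y y′ s s′ t t′)
0-linear : ∀ c d → 0ℚi ≡ (c *ℚi 0ℚi) +ℚi (d *ℚi 0ℚi)
0-linear (c , c′) (d , d′) = cong₂ _,_
  (solveℚ 4 (λ c c′ d d′ → o := (c :* o :- c′ :* o) :+ (d :* o :- d′ :* o)) refl c c′ d d′)
  (solveℚ 4 (λ c c′ d d′ → o := (c :* o :+ c′ :* o) :+ (d :* o :+ d′ :* o)) refl c c′ d d′)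
  where
  o : ∀ {n} → ℚSolver.+-*-Solver.Polynomial n
  o = con ℚ.0ℚ

-- Here `q` is to clear the entry `r`, and `p` the sum `s` over the remaining entries.
clear-factor : ∀ p q r z s →
  (q *ℚi p) *ℚi ((r *ℚi z) +ℚi s) ≡ (p *ℚi ((q *ℚi r) *ℚi z)) +ℚi (q *ℚi (p *ℚi s))
clear-factor (p , p′) (q , q′) (r , r′) (z , z′) (s , s′) = cong₂ _,_
  (solveℚ 10 (λ p p′ q q′ r r′ z z′ s s′ →
     (q :* p :- q′ :* p′) :* ((r :* z :- r′ :* z′) :+ s) :- (q :* p′ :+ q′ :* p) :* ((r :* z′ :+ r′ :* z) :+ s′)
     := (p :* ((q :* r :- q′ :* r′) :* z :- (q :* r′ :+ q′ :* r) :* z′)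
          :- p′ :* ((q :* r :- q′ :* r′) :* z′ :+ (q :* r′ :+ q′ :* r) :* z))
        :+ (q :* (p :* s :- p′ :* s′) :- q′ :* (p :* s′ :+ p′ :* s)))
     refl p p′ q q′ r r′ z z′ s s′)
  (solveℚ 10 (λ p p′ q q′ r r′ z z′ s s′ →
     (q :* p :- q′ :* p′) :* ((r :* z′ :+ r′ :* z) :+ s′) :+ (q :* p′ :+ q′ :* p) :* ((r :* z :- r′ :* z′) :+ s)
     := (p :* ((q :* r :- q′ :* r′) :* z′ :+ (q :* r′ :+ q′ :* r) :* z)
          :+ p′ :* ((q :* r :- q′ :* r′) :* z :- (q :* r′ :+ q′ :* r) :* z′))
        :+ (q :* (p :* s′ :+ p′ :* s) :+ q′ :* (p :* s :- p′ :* s′)))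
     refl p p′ q q′ r r′ z z′ s s′)

-- `(A · z) i` is `dot (A i) z` by definition, which lets rows be treated one at a time by induction
-- on their length.
dot : ∀ {v} → (Fin v → ℚi) → (Fin v → ℤi) → ℚi
dot r z = foldr _+ℚi_ 0ℚi (λ j → r j *ℚi ι (z j))

dot-cong : ∀ {v} (r : Fin v → ℚi) {z z′} → (∀ j → z j ≡ z′ j) → dot r z ≡ dot r z′
dot-cong {zero}  r eq = refl
dot-cong {suc v} r eq = cong₂ (λ x y → (r zero *ℚi ι x) +ℚi y) (eq zero) (dot-cong (r ∘ suc) (eq ∘ suc))

dot-linear : ∀ {v} (r : Fin v → ℚi) c z d y →
  dot r (λ j → (c *ℤi z j) +ℤi (d *ℤi y j)) ≡ (ι c *ℚi dot r z) +ℚi (ι d *ℚi dot r y)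
dot-linear {zero}  r c z d y = 0-linear (ι c) (ι d)
dot-linear {suc v} r c z d y = trans
  (cong₂ (λ x s → (r zero *ℚi x) +ℚi s)
    (trans (ι-homo-+ (c *ℤi z zero) (d *ℤi y zero)) (cong₂ _+ℚi_ (ι-homo-* c (z zero)) (ι-homo-* d (y zero))))
    (dot-linear (r ∘ suc) c (z ∘ suc) d (y ∘ suc)))
  (*ℚi-linear (r zero) (ι c) (ι (z zero)) (ι d) (ι (y zero)) (dot (r ∘ suc) (z ∘ suc)) (dot (r ∘ suc) (y ∘ suc)))

-- Matrix rows as integer linear forms in real and imaginary coordinates

real : ℤ → ℤi
real a = (a , 0ℤ)

real-homo-* : ∀ a b → real (a * b) ≡ real a *ℤi real b
real-homo-* a b = cong₂ _,_ (lemma₁ a b) (lemma₂ a b)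
  where
  lemma₁ : ∀ a b → a * b ≡ a * b ℤ.- 0ℤ * 0ℤ
  lemma₁ = solve-∀
  lemma₂ : ∀ a b → 0ℤ ≡ a * 0ℤ + 0ℤ * b
  lemma₂ = solve-∀

fromCoordinates : ∀ {v} → Vec ℤ (v ℕ.* 2) → Fin v → ℤi
fromCoordinates {suc v} (a ∷ b ∷ x) zero    = (a , b)
fromCoordinates {suc v} (a ∷ b ∷ x) (suc j) = fromCoordinates x j

toCoordinates : ∀ {v} → (Fin v → ℤi) → Vec ℤ (v ℕ.* 2)
toCoordinates {zero}  z = []
toCoordinates {suc v} z = proj₁ (z zero) ∷ proj₂ (z zero) ∷ toCoordinates (z ∘ suc)

from∘toCoordinates : ∀ {v} (z : Fin v → ℤi) j → fromCoordinates (toCoordinates z) j ≡ z j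
from∘toCoordinates z zero    = refl
from∘toCoordinates z (suc j) = from∘toCoordinates (z ∘ suc) j

-- The denominator is an ordinary integer, so that the row taking the value 1 amounts to the two
-- integer equations `re x ≡ denominator` and `im x ≡ 0ℤ`.
record IntegralRow {v} (r : Fin v → ℚi) : Set where
  field
    denominator   : ℤ
    denominator≢0 : ¬ denominator ≡ 0ℤ
    re im         : Vec ℤ (v ℕ.* 2) → ℤ
    re-linear     : Linear re
    im-linear     : Linear im
    integral      : ∀ x → ι (real denominator) *ℚi dot r (fromCoordinates x) ≡ ι (re x , im x)

clear-entry : ∀ r → Σ ℤ λ q → Σ ℤi λ n → ¬ q ≡ 0ℤ × ι (real q) *ℚi r ≡ ι n
clear-entry (a , b) = q , n , q≢0 , cong₂ _,_ real-part imaginary-part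
  where
  q = ℚ.↧ a * ℚ.↧ b
  n = (ℚ.↥ a * ℚ.↧ b , ℚ.↥ b * ℚ.↧ a)
  q≢0 : ¬ q ≡ 0ℤ
  q≢0 ()
  open ≡-Reasoning
  real-part : fromℤ q ℚ.* a ℚ.- ℚ.0ℚ ℚ.* b ≡ fromℤ (ℚ.↥ a * ℚ.↧ b)
  real-part = begin
    fromℤ q ℚ.* a ℚ.- ℚ.0ℚ ℚ.* b                        ≡⟨ cong (λ x → x ℚ.* a ℚ.- ℚ.0ℚ ℚ.* b) (fromℤ-homo-* (ℚ.↧ a) (ℚ.↧ b)) ⟩
    (fromℤ (ℚ.↧ a) ℚ.* fromℤ (ℚ.↧ b)) ℚ.* a ℚ.- ℚ.0ℚ ℚ.* b
      ≡⟨ solveℚ 4 (λ p q a b → (p :* q) :* a :- con ℚ.0ℚ :* b := (p :* a) :* q) refl (fromℤ (ℚ.↧ a)) (fromℤ (ℚ.↧ b)) a b ⟩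
    (fromℤ (ℚ.↧ a) ℚ.* a) ℚ.* fromℤ (ℚ.↧ b)             ≡⟨ cong (ℚ._* fromℤ (ℚ.↧ b)) (clear-denominator a) ⟩
    fromℤ (ℚ.↥ a) ℚ.* fromℤ (ℚ.↧ b)                     ≡⟨ fromℤ-homo-* (ℚ.↥ a) (ℚ.↧ b) ⟨
    fromℤ (ℚ.↥ a * ℚ.↧ b)                               ∎
  imaginary-part : fromℤ q ℚ.* b ℚ.+ ℚ.0ℚ ℚ.* a ≡ fromℤ (ℚ.↥ b * ℚ.↧ a)
  imaginary-part = begin
    fromℤ q ℚ.* b ℚ.+ ℚ.0ℚ ℚ.* a                        ≡⟨ cong (λ x → x ℚ.* b ℚ.+ ℚ.0ℚ ℚ.* a) (fromℤ-homo-* (ℚ.↧ a) (ℚ.↧ b)) ⟩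
    (fromℤ (ℚ.↧ a) ℚ.* fromℤ (ℚ.↧ b)) ℚ.* b ℚ.+ ℚ.0ℚ ℚ.* a
      ≡⟨ solveℚ 4 (λ p q a b → (p :* q) :* b :+ con ℚ.0ℚ :* a := (q :* b) :* p) refl (fromℤ (ℚ.↧ a)) (fromℤ (ℚ.↧ b)) a b ⟩
    (fromℤ (ℚ.↧ b) ℚ.* b) ℚ.* fromℤ (ℚ.↧ a)             ≡⟨ cong (ℚ._* fromℤ (ℚ.↧ a)) (clear-denominator b) ⟩
    fromℤ (ℚ.↥ b) ℚ.* fromℤ (ℚ.↧ a)                     ≡⟨ fromℤ-homo-* (ℚ.↥ b) (ℚ.↧ a) ⟨
    fromℤ (ℚ.↥ b * ℚ.↧ a)                               ∎

integralRow : ∀ {v} (r : Fin v → ℚi) → IntegralRow r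
integralRow {zero} r = record
  { denominator = 1ℤ ; denominator≢0 = λ () ; re = λ _ → 0ℤ ; im = λ _ → 0ℤ
  ; re-linear = λ _ k _ → 0-lin k ; im-linear = λ _ k _ → 0-lin k ; integral = λ _ → refl }
  where
  0-lin : ∀ k → 0ℤ ≡ 0ℤ + k * 0ℤ
  0-lin = solve-∀
integralRow {suc v} r = record
  { denominator   = q * denominator
  ; denominator≢0 = λ eq → [ q≢0 , denominator≢0 ]′ (ℤ.i*j≡0⇒i≡0∨j≡0 q eq)
  ; re            = λ { (a ∷ b ∷ x) → proj₁ (form (a , b) x) }
  ; im            = λ { (a ∷ b ∷ x) → proj₂ (form (a , b) x) }
  ; re-linear     = λ { (a ∷ b ∷ x) k (a′ ∷ b′ ∷ x′) → trans
      (cong₂ (λ s t → proj₁ (combination (a + k * a′ , b + k * b′) (s , t))) (re-linear x k x′) (im-linear x k x′))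
      (lemma₁ denominator q (proj₁ n) (proj₂ n) 0ℤ k a b (re x) (im x) a′ b′ (re x′) (im x′)) }
  ; im-linear     = λ { (a ∷ b ∷ x) k (a′ ∷ b′ ∷ x′) → trans
      (cong₂ (λ s t → proj₂ (combination (a + k * a′ , b + k * b′) (s , t))) (re-linear x k x′) (im-linear x k x′))
      (lemma₂ denominator q (proj₁ n) (proj₂ n) 0ℤ k a b (re x) (im x) a′ b′ (re x′) (im x′)) }
  ; integral      = λ { (a ∷ b ∷ x) → equation (a , b) x }
  }
  where
  open IntegralRow (integralRow (r ∘ suc))
  entry = clear-entry (r zero)
  q = proj₁ entry
  n = proj₁ (proj₂ entry)
  q≢0 = proj₁ (proj₂ (proj₂ entry))
  combination : ℤi → ℤi → ℤi
  combination z s = (real denominator *ℤi (n *ℤi z)) +ℤi (real q *ℤi s)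
  form : ℤi → Vec ℤ (v ℕ.* 2) → ℤi
  form z x = combination z (re x , im x)
  -- `o` stands for the zero imaginary part of the real multipliers; the identities hold for every
  -- value of it.
  lemma₁ : ∀ p q m n o k a b s t a′ b′ s′ t′ →
    (p * (m * (a + k * a′) ℤ.- n * (b + k * b′)) ℤ.- o * (m * (b + k * b′) + n * (a + k * a′)))
      + (q * (s + k * s′) ℤ.- o * (t + k * t′)) ≡
    ((p * (m * a ℤ.- n * b) ℤ.- o * (m * b + n * a)) + (q * s ℤ.- o * t))
      + k * ((p * (m * a′ ℤ.- n * b′) ℤ.- o * (m * b′ + n * a′)) + (q * s′ ℤ.- o * t′))
  lemma₁ = solve-∀
  lemma₂ : ∀ p q m n o k a b s t a′ b′ s′ t′ →
    (p * (m * (b + k * b′) + n * (a + k * a′)) + o * (m * (a + k * a′) ℤ.- n * (b + k * b′)))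
      + (q * (t + k * t′) + o * (s + k * s′)) ≡
    ((p * (m * b + n * a) + o * (m * a ℤ.- n * b)) + (q * t + o * s))
      + k * ((p * (m * b′ + n * a′) + o * (m * a′ ℤ.- n * b′)) + (q * t′ + o * s′))
  lemma₂ = solve-∀
  open ≡-Reasoning
  equation : ∀ z x → ι (real (q * denominator)) *ℚi ((r zero *ℚi ι z) +ℚi dot (r ∘ suc) (fromCoordinates x)) ≡ ι (form z x)
  equation z x = begin
    ι (real (q * denominator)) *ℚi ((r zero *ℚi ι z) +ℚi D)
      ≡⟨ cong (_*ℚi ((r zero *ℚi ι z) +ℚi D)) (trans (cong ι (real-homo-* q denominator)) (ι-homo-* (real q) (real denominator))) ⟩
    (Q *ℚi P) *ℚi ((r zero *ℚi ι z) +ℚi D)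
      ≡⟨ clear-factor P Q (r zero) (ι z) D ⟩
    (P *ℚi ((Q *ℚi r zero) *ℚi ι z)) +ℚi (Q *ℚi (P *ℚi D))
      ≡⟨ cong₂ (λ s t → (P *ℚi (s *ℚi ι z)) +ℚi (Q *ℚi t)) (proj₂ (proj₂ (proj₂ entry))) (integral x) ⟩
    (P *ℚi (ι n *ℚi ι z)) +ℚi (Q *ℚi ι (re x , im x))
      ≡⟨ cong (λ s → (P *ℚi s) +ℚi (Q *ℚi ι (re x , im x))) (ι-homo-* n z) ⟨
    (P *ℚi ι (n *ℤi z)) +ℚi (Q *ℚi ι (re x , im x))
      ≡⟨ cong₂ _+ℚi_ (ι-homo-* (real denominator) (n *ℤi z)) (ι-homo-* (real q) (re x , im x)) ⟨
    ι (real denominator *ℤi (n *ℤi z)) +ℚi ι (real q *ℤi (re x , im x))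
      ≡⟨ ι-homo-+ (real denominator *ℤi (n *ℤi z)) (real q *ℤi (re x , im x)) ⟨
    ι (form z x) ∎
    where
    D = dot (r ∘ suc) (fromCoordinates x)
    P = ι (real denominator)
    Q = ι (real q)

*ℚi-cancel : ∀ q → ¬ q ≡ 0ℤ → ∀ x → ι (real q) *ℚi x ≡ ι (real q) → x ≡ 1ℚi
*ℚi-cancel q q≢0 (a , b) eq = cong₂ _,_
  (begin
    a                                          ≡⟨ ℚ.*-identityˡ a ⟨
    ℚ.1ℚ ℚ.* a                                 ≡⟨ cong (ℚ._* a) (ℚ.*-inverseˡ Q) ⟨
    (ℚ.1/ Q ℚ.* Q) ℚ.* a                       ≡⟨ solveℚ 4 (λ p q a b → (p :* q) :* a := p :* (q :* a :- con ℚ.0ℚ :* b)) refl (ℚ.1/ Q) Q a b ⟩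
    ℚ.1/ Q ℚ.* (Q ℚ.* a ℚ.- ℚ.0ℚ ℚ.* b)        ≡⟨ cong (ℚ.1/ Q ℚ.*_) (cong proj₁ eq) ⟩
    ℚ.1/ Q ℚ.* Q                               ≡⟨ ℚ.*-inverseˡ Q ⟩
    ℚ.1ℚ                                       ∎)
  (begin
    b                                          ≡⟨ ℚ.*-identityˡ b ⟨
    ℚ.1ℚ ℚ.* b                                 ≡⟨ cong (ℚ._* b) (ℚ.*-inverseˡ Q) ⟨
    (ℚ.1/ Q ℚ.* Q) ℚ.* b                       ≡⟨ solveℚ 4 (λ p q a b → (p :* q) :* b := p :* (q :* b :+ con ℚ.0ℚ :* a)) refl (ℚ.1/ Q) Q a b ⟩
    ℚ.1/ Q ℚ.* (Q ℚ.* b ℚ.+ ℚ.0ℚ ℚ.* a)        ≡⟨ cong (ℚ.1/ Q ℚ.*_) (cong proj₂ eq) ⟩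
    ℚ.1/ Q ℚ.* ℚ.0ℚ                            ≡⟨ ℚ.*-zeroʳ (ℚ.1/ Q) ⟩
    ℚ.0ℚ                                       ∎)
  where
  open ≡-Reasoning
  Q = fromℤ q
  instance
    Q-nonZero : ℚ.NonZero Q
    Q-nonZero = ℚ.≢-nonZero (λ Q≡0 → q≢0 (fromℤ-injective Q≡0))

-- Congruence classes and the implication from (a) to (b)

CongruentToOne : ℕ → ℤi → Set
CongruentToOne M y = NonZero y × ∃[ s ] y ≡ ((1ℤ + + M * proj₁ s) , + M * proj₂ s)

-- An odd number is not zero. Hence the doubled modulus: the class of 1 modulo `N` itself contains 0
-- when `N` is 1.
1+2Nx≢0 : ∀ N x → ¬ 1ℤ + + (2 ℕ.* N) * x ≡ 0ℤ
1+2Nx≢0 N x eq with ℕ.∣1⇒≡1 (∣⇒∣ᵤ (divides (- (+ N * x)) (begin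
    1ℤ                                    ≡⟨ lemma (+ N) x ⟩
    (1ℤ + + 2 * + N * x) + - (+ N * x) * + 2  ≡⟨ cong (λ y → (1ℤ + y * x) + - (+ N * x) * + 2) (ℤ.pos-* 2 N) ⟨
    (1ℤ + + (2 ℕ.* N) * x) + - (+ N * x) * + 2  ≡⟨ cong (_+ - (+ N * x) * + 2) eq ⟩
    0ℤ + - (+ N * x) * + 2                ≡⟨ ℤ.+-identityˡ _ ⟩
    - (+ N * x) * + 2                     ∎)))
  where
  open ≡-Reasoning
  lemma : ∀ N x → 1ℤ ≡ (1ℤ + + 2 * N * x) + - (N * x) * + 2
  lemma = solve-∀
... | ()

-- Adding 1 minus the residue of `f` moves `f` into the class, and there are finitely many residues.
-- The class is even syndetic, so `x` is 0 for every `F`.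
congruentToOne-syndetic : ∀ N .{{_ : ℕ.NonZero N}} → PiecewiseSyndetic (CongruentToOne (2 ℕ.* N))
congruentToOne-syndetic N = G , (λ G≡[] → ∉[] (subst (shift 0ℤi ∈_) G≡[] (shift∈G 0ℤi))) , λ F _ → 0ℤi , λ f _ →
  shift f , shift∈G f , nonzero f , (proj₁ f / + M , proj₂ f / + M) , shifted f
  where
  M = 2 ℕ.* N
  instance
    M-nonZero : ℕ.NonZero M
    M-nonZero = ℕ.m*n≢0 2 N
  ∉[] : ∀ {x : ℤi} → ¬ x ∈ []
  ∉[] ()
  residue : ℕ → ℕ → ℤi
  residue a b = (1ℤ ℤ.- + a , - + b)
  G = cartesianProductWith residue (upTo M) (upTo M)
  shift : ℤi → ℤi
  shift (a , b) = residue (a % + M) (b % + M)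
  shift∈G : ∀ f → shift f ∈ G
  shift∈G (a , b) = ∈-cartesianProductWith⁺ residue (∈-upTo⁺ (n%d<d a (+ M))) (∈-upTo⁺ (n%d<d b (+ M)))
  shifted : ∀ f → shift f +ℤi (f +ℤi 0ℤi) ≡ (1ℤ + + M * (proj₁ f / + M) , + M * (proj₂ f / + M))
  shifted (a , b) = cong₂ _,_
    (trans (cong (λ x → (1ℤ ℤ.- + (a % + M)) + (x + 0ℤ)) (a≡a%n+[a/n]*n a (+ M))) (lemma₁ (+ (a % + M)) (a / + M) (+ M)))
    (trans (cong (λ x → - + (b % + M) + (x + 0ℤ)) (a≡a%n+[a/n]*n b (+ M))) (lemma₂ (+ (b % + M)) (b / + M) (+ M)))
    where
    lemma₁ : ∀ r q M → (1ℤ ℤ.- r) + ((r + q * M) + 0ℤ) ≡ 1ℤ + M * q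
    lemma₁ = solve-∀
    lemma₂ : ∀ r q M → - r + ((r + q * M) + 0ℤ) ≡ M * q
    lemma₂ = solve-∀
  nonzero : ∀ f → NonZero (shift f +ℤi (f +ℤi 0ℤi))
  nonzero f eq = 1+2Nx≢0 N _ (cong proj₁ (trans (sym (shifted f)) eq))

ImageMeetsPiecewiseSyndetic : ∀ {u v} → Matrix u v → Set₁
ImageMeetsPiecewiseSyndetic {u} {v} A = (P : ℤi → Set) → (∀ y → P y → NonZero y) → PiecewiseSyndetic P →
  Σ (Fin v → ℤi) λ z → (∀ l → NonZero (z l)) × ImageIn A z P

OneInImage : ∀ {u v} → Matrix u v → Set
OneInImage {u} {v} A = Σ (Fin v → ℤi) λ z → ∀ i → (A · z) i ≡ 1ℚi

image-meets⇒one-in-image : ∀ {u v} (A : Matrix u v) → ImageMeetsPiecewiseSyndetic A → OneInImage A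
image-meets⇒one-in-image {u} {v} A meets = fromCoordinates x , λ i →
  *ℚi-cancel (q i) (IntegralRow.denominator≢0 (row i)) _ (trans (IntegralRow.integral (row i) x)
    (cong₂ (λ a b → ι (a , b)) (All.tabulate⁻ (All.++⁻ˡ (tabulate re-equation) solves) i)
                               (All.tabulate⁻ (All.++⁻ʳ (tabulate re-equation) solves) i)))
  where
  row : ∀ i → IntegralRow (A i)
  row i = integralRow (A i)
  q : Fin u → ℤ
  q i = IntegralRow.denominator (row i)
  re-equation im-equation : Fin u → Equation (v ℕ.* 2)
  re-equation i = record { lhs = IntegralRow.re (row i) ; linear = IntegralRow.re-linear (row i) ; rhs = q i }
  im-equation i = record { lhs = IntegralRow.im (row i) ; linear = IntegralRow.im-linear (row i) ; rhs = 0ℤ }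
  -- The modulus depends on the cleared system alone, so (a) is applied only once.
  modulus = solvable-of-mod (tabulate re-equation ++ tabulate im-equation)
  N = proj₁ modulus
  solution = meets (CongruentToOne (2 ℕ.* N)) (λ _ → proj₁)
    (congruentToOne-syndetic N {{proj₁ (proj₂ modulus)}})
  z = proj₁ solution
  w = proj₁ (proj₂ (proj₂ solution))
  ι-w : ∀ i → ι (w i) ≡ dot (A i) z
  ι-w = proj₁ (proj₂ (proj₂ (proj₂ solution)))
  s : Fin u → ℤi
  s i = proj₁ (proj₂ (proj₂ (proj₂ (proj₂ (proj₂ solution))) i))
  w≡1+2Ns : ∀ i → w i ≡ (1ℤ + + (2 ℕ.* N) * proj₁ (s i) , + (2 ℕ.* N) * proj₂ (s i))
  w≡1+2Ns i = proj₂ (proj₂ (proj₂ (proj₂ (proj₂ (proj₂ solution))) i))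
  x₀ = toCoordinates z
  open ≡-Reasoning
  values : ∀ i → (IntegralRow.re (row i) x₀ , IntegralRow.im (row i) x₀) ≡ real (q i) *ℤi w i
  values i = ι-injective (begin
    ι (IntegralRow.re (row i) x₀ , IntegralRow.im (row i) x₀)   ≡⟨ IntegralRow.integral (row i) x₀ ⟨
    ι (real (q i)) *ℚi dot (A i) (fromCoordinates x₀)
      ≡⟨ cong (ι (real (q i)) *ℚi_) (trans (dot-cong (A i) (from∘toCoordinates z)) (sym (ι-w i))) ⟩
    ι (real (q i)) *ℚi ι (w i)                                  ≡⟨ ι-homo-* (real (q i)) (w i) ⟨
    ι (real (q i) *ℤi w i)                                      ∎)
  lemma₁ : ∀ q N s t → q * (1ℤ + + 2 * N * s) ℤ.- 0ℤ * t ≡ q + N * (+ 2 * q * s)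
  lemma₁ = solve-∀
  lemma₂ : ∀ q N s t → q * (+ 2 * N * s) + 0ℤ * t ≡ 0ℤ + N * (+ 2 * q * s)
  lemma₂ = solve-∀
  solution-mod : SolvableMod N (tabulate re-equation ++ tabulate im-equation)
  solution-mod = x₀ , All.++⁺
    -- Since `w i` is 1 plus `2 N` times `s i`, multiplying by `q i` leaves `N` times `2 q s` as the
    -- error.
    (All.tabulate⁺ λ i → + 2 * q i * proj₁ (s i) , (begin
      IntegralRow.re (row i) x₀                                            ≡⟨ cong proj₁ (values i) ⟩
      q i * proj₁ (w i) ℤ.- 0ℤ * proj₂ (w i)
        ≡⟨ cong (λ y → q i * y ℤ.- 0ℤ * proj₂ (w i)) (trans (cong proj₁ (w≡1+2Ns i)) (cong (λ m → 1ℤ + m * proj₁ (s i)) (ℤ.pos-* 2 N))) ⟩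
      q i * (1ℤ + + 2 * + N * proj₁ (s i)) ℤ.- 0ℤ * proj₂ (w i)            ≡⟨ lemma₁ (q i) (+ N) (proj₁ (s i)) (proj₂ (w i)) ⟩
      q i + + N * (+ 2 * q i * proj₁ (s i))                                ∎))
    (All.tabulate⁺ λ i → + 2 * q i * proj₂ (s i) , (begin
      IntegralRow.im (row i) x₀                                            ≡⟨ cong proj₂ (values i) ⟩
      q i * proj₂ (w i) + 0ℤ * proj₁ (w i)
        ≡⟨ cong (λ y → q i * y + 0ℤ * proj₁ (w i)) (trans (cong proj₂ (w≡1+2Ns i)) (cong (_* proj₂ (s i)) (ℤ.pos-* 2 N))) ⟩
      q i * (+ 2 * + N * proj₂ (s i)) + 0ℤ * proj₁ (w i)                   ≡⟨ lemma₂ (q i) (+ N) (proj₂ (s i)) (proj₁ (w i)) ⟩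
      0ℤ + + N * (+ 2 * q i * proj₂ (s i))                                 ∎))
  solved = proj₂ (proj₂ modulus) solution-mod
  x = proj₁ solved
  solves = proj₂ solved

-- Piecewise syndetic sets and the implication from (b) to (a)

_≟ℤi_ : DecidableEquality ℤi
_≟ℤi_ = ≡-dec ℤ._≟_ ℤ._≟_

open DecMembership _≟ℤi_ using (_∈?_)

-- The colour of a point of `F` is the position in `G` of its chosen translate. Points outside `F`
-- get colour zero, which exists because `G` is nonempty.
choice-colouring : ∀ (B : ℤi → ℤi → Set) G F → NonEmpty G → (∀ f → f ∈ F → ∃ λ t → t ∈ G × B t f) →
  Σ (ℤi → Fin (length G)) λ χ → ∀ {f} → f ∈ F → B (lookup G (χ f)) f
choice-colouring B []      F G≢[] choose = contradiction refl G≢[]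
choice-colouring B (g ∷ G) F G≢[] choose = χ , χ-correct
  where
  χ : ℤi → Fin (suc (length G))
  χ f with f ∈? F
  ... | yes f∈F = Any.index (proj₁ (proj₂ (choose f f∈F)))
  ... | no  _   = zero
  χ-correct : ∀ {f} → f ∈ F → B (lookup (g ∷ G) (χ f)) f
  χ-correct {f} f∈F with f ∈? F
  ... | no f∉F = contradiction f∈F f∉F
  ... | yes p with choose f p
  ...   | t , t∈G , b = subst (λ t → B t f) (Any.lookup-index t∈G) b

-- If `A z` is constantly 1 and `A y` is `w`, then `A` sends this vector to `n + d (w + m)`, a point
-- of the homothetic copy of the shifts `w + m`.
perturbed : ∀ {v} → (z y : Fin v → ℤi) → ℤi → ℕ → ℕ → Fin v → ℤi
perturbed z y n d m l = ((n +ℤi real (+ d * + m)) *ℤi z l) +ℤi (real (+ d) *ℤi y l)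

-- An entry vanishes for at most one of the v + 1 values of m.
nonzero-perturbation : ∀ {v} (z y : Fin v → ℤi) → (∀ l → NonZero (y l)) → ∀ n d → 0 ℕ.< d →
  Σ (Fin (suc v)) λ m → ∀ l → NonZero (perturbed z y n d (Fin.toℕ m) l)
nonzero-perturbation {v} z y y≢0 n d d>0 with Fin.any? (λ m → Fin.all? (λ l → nonzero? m l))
  where
  nonzero? : ∀ (m : Fin (suc v)) l → _
  nonzero? m l = ¬? (perturbed z y n d (Fin.toℕ m) l ≟ℤi 0ℤi)
... | yes good = good
... | no ¬good = ⊥-elim absurd
  where
  entry : Fin (suc v) → Fin v → ℤi
  entry m = perturbed z y n d (Fin.toℕ m)
  vanishing : ∀ m → ∃[ l ] entry m l ≡ 0ℤi
  vanishing m with Fin.¬∀⟶∃¬ v _ (λ l → ¬? (entry m l ≟ℤi 0ℤi)) (λ all → ¬good (m , all))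
  ... | l , ¬¬eq = l , decidable-stable (entry m l ≟ℤi 0ℤi) ¬¬eq
  cancel : ∀ m m′ → m ℕ.< m′ → ∀ x → + d * (+ m′ ℤ.- + m) * x ≡ 0ℤ → x ≡ 0ℤ
  cancel m m′ m<m′ x eq with ℤ.i*j≡0⇒i≡0∨j≡0 (+ d * (+ m′ ℤ.- + m)) eq
  ... | inj₂ x≡0 = x≡0
  ... | inj₁ eq′ with ℤ.i*j≡0⇒i≡0∨j≡0 (+ d) eq′
  ...   | inj₁ d≡0 = contradiction (ℤ.+-injective (sym d≡0)) (ℕ.<⇒≢ d>0)
  ...   | inj₂ m′-m≡0 = contradiction (ℤ.+-injective (sym (ℤ.i-j≡0⇒i≡j (+ m′) (+ m) m′-m≡0))) (ℕ.<⇒≢ m<m′)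
  cancel-d : ∀ x → + d * x ≡ 0ℤ → x ≡ 0ℤ
  cancel-d x eq with ℤ.i*j≡0⇒i≡0∨j≡0 (+ d) eq
  ... | inj₁ d≡0 = contradiction (ℤ.+-injective (sym d≡0)) (ℕ.<⇒≢ d>0)
  ... | inj₂ x≡0 = x≡0
  -- The difference of the two entries is `d (m′ - m)` times `z l`, so `z l` vanishes, and what
  -- remains of either entry is `d` times `y l`.
  twice-vanishing : ∀ m m′ → m ℕ.< m′ → ∀ l →
    perturbed z y n d m l ≡ 0ℤi → perturbed z y n d m′ l ≡ 0ℤi → y l ≡ 0ℤi
  twice-vanishing m m′ m<m′ l eq eq′ with z l | y l
  ... | (a , b) | (p , q) = cong₂ _,_
    (cancel-d p (trans (lemma₃ (proj₁ n) (proj₂ n) (+ d) (+ m) p q)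
      (trans (cong₂ (λ a b → re (+ m) a b p q) (sym a≡0) (sym b≡0)) (cong proj₁ eq))))
    (cancel-d q (trans (lemma₄ (proj₁ n) (proj₂ n) (+ d) (+ m) p q)
      (trans (cong₂ (λ a b → im (+ m) a b p q) (sym a≡0) (sym b≡0)) (cong proj₂ eq))))
    where
    re im : ℤ → ℤ → ℤ → ℤ → ℤ → ℤ
    re m a b p q = ((proj₁ n + + d * m) * a ℤ.- (proj₂ n + 0ℤ) * b) + (+ d * p ℤ.- 0ℤ * q)
    im m a b p q = ((proj₁ n + + d * m) * b + (proj₂ n + 0ℤ) * a) + (+ d * q + 0ℤ * p)
    lemma₁ : ∀ n n′ d m m′ a b p q → d * (m′ ℤ.- m) * a ≡
      (((n + d * m′) * a ℤ.- (n′ + 0ℤ) * b) + (d * p ℤ.- 0ℤ * q)) ℤ.-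
      (((n + d * m) * a ℤ.- (n′ + 0ℤ) * b) + (d * p ℤ.- 0ℤ * q))
    lemma₁ = solve-∀
    lemma₂ : ∀ n n′ d m m′ a b p q → d * (m′ ℤ.- m) * b ≡
      (((n + d * m′) * b + (n′ + 0ℤ) * a) + (d * q + 0ℤ * p)) ℤ.-
      (((n + d * m) * b + (n′ + 0ℤ) * a) + (d * q + 0ℤ * p))
    lemma₂ = solve-∀
    lemma₃ : ∀ n n′ d m p q → d * p ≡ ((n + d * m) * 0ℤ ℤ.- (n′ + 0ℤ) * 0ℤ) + (d * p ℤ.- 0ℤ * q)
    lemma₃ = solve-∀
    lemma₄ : ∀ n n′ d m p q → d * q ≡ ((n + d * m) * 0ℤ + (n′ + 0ℤ) * 0ℤ) + (d * q + 0ℤ * p)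
    lemma₄ = solve-∀
    a≡0 : a ≡ 0ℤ
    a≡0 = cancel m m′ m<m′ a (trans (lemma₁ (proj₁ n) (proj₂ n) (+ d) (+ m) (+ m′) a b p q)
      (cong₂ ℤ._-_ (cong proj₁ eq′) (cong proj₁ eq)))
    b≡0 : b ≡ 0ℤ
    b≡0 = cancel m m′ m<m′ b (trans (lemma₂ (proj₁ n) (proj₂ n) (+ d) (+ m) (+ m′) a b p q)
      (cong₂ ℤ._-_ (cong proj₂ eq′) (cong proj₂ eq)))
  absurd : ⊥
  -- Each of the `v + 1` values of `m` picks one of `v` positions, so two of them make the same
  -- entry vanish.
  absurd with Fin.pigeonhole (ℕ.n<1+n v) (proj₁ ∘ vanishing)
  ... | i , j , i<j , eq = y≢0 (proj₁ (vanishing i)) (twice-vanishing (Fin.toℕ i) (Fin.toℕ j) i<j _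
          (proj₂ (vanishing i)) (subst (λ l → entry j l ≡ 0ℤi) (sym eq) (proj₂ (vanishing j))))

one-in-image⇒image-meets : ∀ {u v} (A : Matrix u v) → ImagePartitionRegular A →
  OneInImage A → ImageMeetsPiecewiseSyndetic A
one-in-image⇒image-meets {u} {v} A ipr (z , Az≡1) P _ (G , G≢[] , thick) with ipr 1 (λ _ → zero)
... | _ , y , y≢0 , w , ι-w , _ =
  perturbed z y n d (Fin.toℕ m) , proj₂ good , w′ , ι-w′ , λ i → w′∈P (shift i m) (shift∈Ω i m)
  where
  shift : Fin u → Fin (suc v) → ℤi
  shift i m = w i +ℤi real (+ Fin.toℕ m)
  -- The added 0 is the reference point; its copy is the base of the homothety.
  Ω = 0ℤi ∷ cartesianProductWith shift (allFin u) (allFin (suc v))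
  shift∈Ω : ∀ i m → shift i m ∈ Ω
  shift∈Ω i m = there (∈-cartesianProductWith⁺ shift (∈-allFin i) (∈-allFin m))
  open ColourFocusing Ω 0ℤi (here refl)
  copies = gallai Ω (λ w∈Ω → w∈Ω) (length G)
  F = proj₁ copies
  -- The added 0 makes the finite set visibly nonempty.
  covered = thick (0ℤi ∷ F) (λ ())
  x = proj₁ covered
  coloured = choice-colouring (λ t f → P (t +ℤi (f +ℤi x))) G F G≢[] (λ f f∈F → proj₂ covered f (there f∈F))
  χ = proj₁ coloured
  mono = proj₂ copies χ
  h = proj₁ mono
  open Homothet h renaming (base to a; ratio to d)
  -- On a monochromatic copy one and the same translate `t` serves all points, so `P` contains `n`
  -- plus `d` times each point of `Ω`, where `n` is `t + a + x`.
  t = lookup G (χ (at h 0ℤi))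
  w′∈P : ∀ ω → ω ∈ Ω → P (t +ℤi (at h ω +ℤi x))
  w′∈P ω ω∈Ω = subst (λ c → P (lookup G c +ℤi (at h ω +ℤi x))) (proj₂ mono ω∈Ω) (proj₂ coloured (inside ω∈Ω))
  n = t +ℤi (a +ℤi x)
  good = nonzero-perturbation z y y≢0 n d ratio>0
  m = proj₁ good
  w′ : Fin u → ℤi
  w′ i = t +ℤi (at h (shift i m) +ℤi x)
  c = n +ℤi real (+ d * + Fin.toℕ m)
  lemma₁ : ∀ t a x d m w w₂ → t + ((a + d * (w + m)) + x) ≡ ((t + (a + x)) + d * m) + (d * w ℤ.- 0ℤ * w₂)
  lemma₁ = solve-∀
  lemma₂ : ∀ t a x d w w₁ → t + ((a + d * (w + 0ℤ)) + x) ≡ ((t + (a + x)) + 0ℤ) + (d * w + 0ℤ * w₁)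
  lemma₂ = solve-∀
  w′≡ : ∀ i → w′ i ≡ c +ℤi (real (+ d) *ℤi w i)
  w′≡ i = cong₂ _,_
    (lemma₁ (proj₁ t) (proj₁ a) (proj₁ x) (+ d) (+ Fin.toℕ m) (proj₁ (w i)) (proj₂ (w i)))
    (lemma₂ (proj₂ t) (proj₂ a) (proj₂ x) (+ d) (proj₂ (w i)) (proj₁ (w i)))
  open ≡-Reasoning
  -- The coefficient 1 of `c` is replaced by the row of `A z`, and `w i` by the row of `A y`, after
  -- which linearity of the row applies.
  ι-w′ : ∀ i → ι (w′ i) ≡ (A · perturbed z y n d (Fin.toℕ m)) i
  ι-w′ i = begin
    ι (w′ i)                                                       ≡⟨ cong ι (w′≡ i) ⟩
    ι (c +ℤi (real (+ d) *ℤi w i))                                 ≡⟨ ι-homo-+ c (real (+ d) *ℤi w i) ⟩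
    ι c +ℚi ι (real (+ d) *ℤi w i)                                 ≡⟨ cong₂ _+ℚi_ (sym (*ℚi-identityʳ (ι c))) (ι-homo-* (real (+ d)) (w i)) ⟩
    (ι c *ℚi 1ℚi) +ℚi (ι (real (+ d)) *ℚi ι (w i))
      ≡⟨ cong₂ (λ p q → (ι c *ℚi p) +ℚi (ι (real (+ d)) *ℚi q)) (sym (Az≡1 i)) (ι-w i) ⟩
    (ι c *ℚi dot (A i) z) +ℚi (ι (real (+ d)) *ℚi dot (A i) y)     ≡⟨ dot-linear (A i) c z (real (+ d)) y ⟨
    (A · perturbed z y n d (Fin.toℕ m)) i                          ∎

theorem2p5 : (u v : ℕ) (A : Matrix u v) → ImagePartitionRegular A →
    (((P : ℤi → Set) → (∀ y → P y → NonZero y) → PiecewiseSyndetic P →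
    Σ (Fin v → ℤi) λ z → (∀ l → NonZero (z l)) × ImageIn A z P)
    ⇔ (Σ (Fin v → ℤi) λ z → ∀ i → (A · z) i ≡ 1ℚi))
theorem2p5 u v A ipr = mk⇔ (image-meets⇒one-in-image A) (one-in-image⇒image-meets A ipr)
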